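{- For all integers $n\ge 1$ and $k\ge 0$, $$\sum_{p} N_O(n,k,p)=\sum_{p} N_E(n,k,p)=2^{k+1}\binom{2n-k-2}{n-1},$$ where the sums are over all integers $p$.
   Context: A lattice path of length $n$ here is a path in the plane starting at the origin $(0,0)$ and consisting of $n$ unit steps, each either E $=(1,0)$ or N $=(0,1)$. For integers $n\ge 1$, $k\ge 0$, $r$, $s$, let $M_{r,s}^{n,k}$ be the number of ordered pairs of lattice paths of length $n$ such that the first path ends at $(r,n-r)$, the second path ends at $(s,n-s)$, and the two paths intersect exactly $k$ times, where intersections at the origin and at the endpoints of the paths are not counted; that is, there are exactly $k$ indices $m$ with $1\le m\le n-1$ such that the two paths are at the same lattice point after $m$ steps. ($M_{r,s}^{n,k}=0$ unless $0\le r,s\le n$.) For an integer $p$ define $$N_E(n,k,p)=\sum_{r+s=2p} M_{r,s}^{n,k},\qquad N_O(n,k,p)=\sum_{r+s=2p+1} M_{r,s}^{n,k},$$ where the sums are over all ordered pairs of integers $(r,s)$ with $0\le r,s\le n$ and the indicated value of $r+s$. (Only finitely many $p$ give nonzero values.) Binomial coefficients $\binom{a}{b}$ are $0$ unless $0\le b\le a$ (in particular they are $0$ when $a<0$). -}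

module Defs where

open import Data.Integer as ℤ using (ℤ; +_; -[1+_])
open import Data.List using (List; []; _∷_; _++_; applyUpTo; cartesianProduct;
  cartesianProductWith; filter; length; map; upTo)
open import Data.Nat using (ℕ; zero; suc; _∸_; _<_)
import Data.Nat as ℕ
open import Data.Nat.Combinatorics using (_C_)
open import Data.Nat.ListAction using (sum)
open import Data.Product using (_×_; _,_; ∃-syntax)
open import Data.Product.Properties using (≡-dec)
open import Data.Vec using (Vec; []; _∷_)
open import Relation.Binary.Definitions using (DecidableEquality)
open import Relation.Binary.PropositionalEquality using (_≡_)
open import Relation.Nullary.Decidable using (Dec; _×-dec_)

Point : Set
Point = ℤ × ℤ

_≟ₚ_ : DecidableEquality Point
_≟ₚ_ = ≡-dec ℤ._≟_ ℤ._≟_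

data Step : Set where
  E N : Step

move : Step → Point → Point
move E (x , y) = (x ℤ.+ + 1 , y)
move N (x , y) = (x , y ℤ.+ + 1)

-- A path from the origin is determined by its sequence of steps.
Path : ℕ → Set
Path n = Vec Step n

-- The point reached after the first m steps (after all n steps if m > n).
-- The steps act by commuting translations, so the first step may be
-- applied last.
after : ∀ {n} → ℕ → Path n → Point
after zero    _       = (+ 0 , + 0)
after (suc m) []      = (+ 0 , + 0)
after (suc m) (s ∷ π) = move s (after m π)

endpoint : ∀ {n} → Path n → Point
endpoint {n} π = after n π

-- The list of all paths of length n, without repetitions.
paths : ∀ n → List (Path n)
paths zero    = [] ∷ []
paths (suc n) = cartesianProductWith _∷_ (E ∷ N ∷ []) (paths n)

-- The number of m ∈ {1, …, n - 1} with both paths at the same point after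
-- m steps; the origin and the endpoints are excluded.
intersections : ∀ {n} → Path n → Path n → ℕ
intersections {n} π ρ =
  length (filter (λ m → after m π ≟ₚ after m ρ) (applyUpTo suc (n ∸ 1)))

Counted : ∀ n → ℕ → ℤ → ℤ → Path n × Path n → Set
Counted n k r s (π , ρ) =
  endpoint π ≡ (r , + n ℤ.- r) ×
  endpoint ρ ≡ (s , + n ℤ.- s) ×
  intersections π ρ ≡ k

counted? : ∀ n k r s (πρ : Path n × Path n) → Dec (Counted n k r s πρ)
counted? n k r s (π , ρ) =
  (endpoint π ≟ₚ (r , + n ℤ.- r)) ×-dec
  (endpoint ρ ≟ₚ (s , + n ℤ.- s)) ×-dec
  (intersections π ρ ℕ.≟ k)

M : ℕ → ℕ → ℤ → ℤ → ℕ
M n k r s = length (filter (counted? n k r s) (cartesianProduct (paths n) (paths n)))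

-- The sum of M n k r s over all 0 ≤ r , s ≤ n with r + s = t.
sumM : ℕ → ℕ → ℤ → ℕ
sumM n k t =
  sum (map (λ (r , s) → M n k (+ r) (+ s))
    (filter (λ (r , s) → (+ r ℤ.+ + s) ℤ.≟ t)
      (cartesianProduct (upTo (suc n)) (upTo (suc n)))))

N-E : ℕ → ℕ → ℤ → ℕ
N-E n k p = sumM n k (+ 2 ℤ.* p)

N-O : ℕ → ℕ → ℤ → ℕ
N-O n k p = sumM n k (+ 2 ℤ.* p ℤ.+ + 1)

-- The integers p with ∣ p ∣ ≤ b, without repetitions.
symmetricInterval : ℕ → List ℤ
symmetricInterval b = map +_ (upTo (suc b)) ++ map -[1+_] (upTo b)

-- f has finite support, and its sum over all of ℤ is S.
SumOverℤ_Is_ : (ℤ → ℕ) → ℕ → Set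
SumOverℤ f Is S = ∃[ b ]
  (∀ p → b < ℤ.∣ p ∣ → f p ≡ 0) × sum (map f (symmetricInterval b)) ≡ S

-- On integers, because 2n - k - 2 can be negative: truncated subtraction
-- would give 0 C 0 = 1 instead of 0 when n = 1 and k ≥ 1.
binomial : ℤ → ℤ → ℕ
binomial (+ a)    (+ b)    = a C b
binomial (+ _)    -[1+ _ ] = 0
binomial -[1+ _ ] _        = 0

{-# OPTIONS --safe #-}
module Submission where

-- The horizontal distance between the two paths is a walk with steps
-- -1, 0, 0, +1, and the paths meet when it is at 0.  The number of such walks
-- of length m from distance d that are at 0 at exactly j + 1 of the times
-- 0, …, m is 2 ^ j * C(2m - j, m + d): as a function of m and d this satisfies
-- the first-step recurrence by Pascal's rule.  For a pair of paths of length
-- m + 1 the last step never changes the number of intersections, and of its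
-- four choices two give each parity of r + s; so each parity class has twice
-- as many pairs as there are walks of length m from 0 with k returns.

open import Defs
open import Data.Bool using (true; false; if_then_else_)
open import Data.Integer using (ℤ; +_; -[1+_]; _-_; _⊖_)
import Data.Integer as ℤ
import Data.Integer.Properties as ℤₚ
import Data.Integer.Tactic.RingSolver as ℤ-Solver
open import Data.List using (List; []; _∷_; _++_; applyUpTo; cartesianProduct;
  filter; length; map; upTo)
open import Data.List.Properties using (map-cong; map-++; map-∘; map-upTo)
open import Data.Nat using (ℕ; zero; suc; _≤_; _<_; _+_; _*_; _^_; _∸_; _≟_; z≤n; s≤s)
  renaming (∣_-_∣ to dist)
open import Data.Nat.Combinatorics using (_C_; nCk≡nC[n∸k]; nCk+nC[k+1]≡[n+1]C[k+1]; k>n⇒nCk≡0)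
open import Data.Nat.ListAction using (sum)
open import Data.Nat.ListAction.Properties using (sum-++)
open import Data.Nat.Properties hiding (_≟_)
open import Data.Nat.Tactic.RingSolver using (solve-∀)
open import Data.Product using (_×_; _,_; proj₁)
open import Data.Vec using ([]; _∷_)
open import Function using (_∘_; _⇔_; mk⇔)
open import Relation.Binary.PropositionalEquality
open import Relation.Nullary using (Dec; does; ¬_)
open import Relation.Nullary.Decidable using (_×-dec_; dec-false; does-⇔)

open ≡-Reasoning

private
  variable
    A B P Q : Set

-- Finite sums

-- Only the Boolean `does` matters, so `suc x ≟ suc y` and `x ≟ y` have definitionally equal
-- indicators; later index shifts rely on this.
⟦_⟧ : Dec P → ℕ
⟦ p? ⟧ = if does p? then 1 else 0

⟦⟧-cong : (p? : Dec P) (q? : Dec Q) → P ⇔ Q → ⟦ p? ⟧ ≡ ⟦ q? ⟧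
⟦⟧-cong p? q? p⇔q = cong (if_then 1 else 0) (does-⇔ p⇔q p? q?)

⟦⟧-false : (p? : Dec P) → ¬ P → ⟦ p? ⟧ ≡ 0
⟦⟧-false p? ¬p = cong (if_then 1 else 0) (dec-false p? ¬p)

⟦⟧-× : (p? : Dec P) (q? : Dec Q) → ⟦ p? ×-dec q? ⟧ ≡ ⟦ p? ⟧ * ⟦ q? ⟧
⟦⟧-× p? q? with does p? | does q?
... | true  | true  = refl
... | true  | false = refl
... | false | _     = refl

∑ : List A → (A → ℕ) → ℕ
∑ xs f = sum (map f xs)

∑-cong : ∀ {f g : A → ℕ} xs → (∀ x → f x ≡ g x) → ∑ xs f ≡ ∑ xs g
∑-cong xs f≗g = cong sum (map-cong f≗g xs)

∑-zero : (xs : List A) → ∑ xs (λ _ → 0) ≡ 0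
∑-zero []       = refl
∑-zero (x ∷ xs) = ∑-zero xs

∑-+ : ∀ (f g : A → ℕ) xs → ∑ xs (λ x → f x + g x) ≡ ∑ xs f + ∑ xs g
∑-+ f g []       = refl
∑-+ f g (x ∷ xs) = begin
  (f x + g x) + ∑ xs (λ x → f x + g x) ≡⟨ cong₂ _+_ refl (∑-+ f g xs) ⟩
  (f x + g x) + (∑ xs f + ∑ xs g)      ≡⟨ +-interchange (f x) (g x) _ _ ⟩
  (f x + ∑ xs f) + (g x + ∑ xs g)      ∎
  where
  +-interchange : ∀ a b c d → (a + b) + (c + d) ≡ (a + c) + (b + d)
  +-interchange = solve-∀

∑-*ˡ : ∀ c (f : A → ℕ) xs → ∑ xs (λ x → c * f x) ≡ c * ∑ xs f
∑-*ˡ c f []       = sym (*-zeroʳ c)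
∑-*ˡ c f (x ∷ xs) = trans (cong₂ _+_ refl (∑-*ˡ c f xs)) (sym (*-distribˡ-+ c (f x) _))

∑-*ʳ : ∀ c (f : A → ℕ) xs → ∑ xs (λ x → f x * c) ≡ ∑ xs f * c
∑-*ʳ c f xs = begin
  ∑ xs (λ x → f x * c) ≡⟨ ∑-cong xs (λ x → *-comm (f x) c) ⟩
  ∑ xs (λ x → c * f x) ≡⟨ ∑-*ˡ c f xs ⟩
  c * ∑ xs f           ≡⟨ *-comm c _ ⟩
  ∑ xs f * c           ∎

∑-swap : ∀ (f : A → B → ℕ) xs ys → ∑ xs (λ x → ∑ ys (f x)) ≡ ∑ ys (λ y → ∑ xs (λ x → f x y))
∑-swap f []       ys = sym (∑-zero ys)
∑-swap f (x ∷ xs) ys = trans (cong₂ _+_ refl (∑-swap f xs ys)) (sym (∑-+ (f x) _ ys))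

∑-++ : ∀ (f : A → ℕ) xs ys → ∑ (xs ++ ys) f ≡ ∑ xs f + ∑ ys f
∑-++ f xs ys = trans (cong sum (map-++ f xs ys)) (sum-++ (map f xs) (map f ys))

∑-map : ∀ (g : A → B) (f : B → ℕ) xs → ∑ (map g xs) f ≡ ∑ xs (f ∘ g)
∑-map g f xs = cong sum (sym (map-∘ xs))

∑-× : ∀ (f : A × B → ℕ) xs ys → ∑ (cartesianProduct xs ys) f ≡ ∑ xs (λ x → ∑ ys (λ y → f (x , y)))
∑-× f []       ys = refl
∑-× f (x ∷ xs) ys = begin
  ∑ (map (x ,_) ys ++ cartesianProduct xs ys) f        ≡⟨ ∑-++ f (map (x ,_) ys) _ ⟩
  ∑ (map (x ,_) ys) f + ∑ (cartesianProduct xs ys) f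
    ≡⟨ cong₂ _+_ (∑-map (x ,_) f ys) (∑-× f xs ys) ⟩
  ∑ ys (λ y → f (x , y)) + ∑ xs (λ x → ∑ ys (λ y → f (x , y))) ∎

∑-filter : ∀ {P : A → Set} (P? : ∀ x → Dec (P x)) f xs →
  ∑ (filter P? xs) f ≡ ∑ xs (λ x → ⟦ P? x ⟧ * f x)
∑-filter P? f []       = refl
∑-filter P? f (x ∷ xs) with does (P? x)
... | true  = cong₂ _+_ (sym (+-identityʳ (f x))) (∑-filter P? f xs)
... | false = ∑-filter P? f xs

length-filter : ∀ {P : A → Set} (P? : ∀ x → Dec (P x)) xs →
  length (filter P? xs) ≡ ∑ xs (λ x → ⟦ P? x ⟧)
length-filter P? []       = refl
length-filter P? (x ∷ xs) with does (P? x)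
... | true  = cong suc (length-filter P? xs)
... | false = length-filter P? xs

∑-upTo-suc : ∀ b (f : ℕ → ℕ) → ∑ (upTo (suc b)) f ≡ f 0 + ∑ (upTo b) (f ∘ suc)
∑-upTo-suc b f = begin
  ∑ (upTo (suc b)) f                 ≡⟨ cong sum (map-upTo f (suc b)) ⟩
  f 0 + sum (applyUpTo (f ∘ suc) b)  ≡⟨ cong (λ xs → f 0 + sum xs) (map-upTo (f ∘ suc) b) ⟨
  f 0 + ∑ (upTo b) (f ∘ suc)         ∎

∑-pick : ∀ b (f : ℕ → ℕ) {x} → x < b → ∑ (upTo b) (λ r → ⟦ x ≟ r ⟧ * f r) ≡ f x
∑-pick (suc b) f {zero} _ = begin
  ∑ (upTo (suc b)) (λ r → ⟦ 0 ≟ r ⟧ * f r)  ≡⟨ ∑-upTo-suc b (λ r → ⟦ 0 ≟ r ⟧ * f r) ⟩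
  f 0 + 0 + ∑ (upTo b) (λ _ → 0)            ≡⟨ cong₂ _+_ (+-identityʳ (f 0)) (∑-zero (upTo b)) ⟩
  f 0 + 0                                   ≡⟨ +-identityʳ (f 0) ⟩
  f 0                                       ∎
∑-pick (suc b) f {suc x} (s≤s x<b) =
  trans (∑-upTo-suc b (λ r → ⟦ suc x ≟ r ⟧ * f r)) (∑-pick b (f ∘ suc) x<b)

∑-paths : ∀ n f → ∑ (paths (suc n)) f ≡ ∑ (paths n) (λ π → f (E ∷ π)) + ∑ (paths n) (λ π → f (N ∷ π))
∑-paths n f = begin
  ∑ (map (E ∷_) ps ++ map (N ∷_) ps ++ []) f                ≡⟨ ∑-++ f (map (E ∷_) ps) _ ⟩
  ∑ (map (E ∷_) ps) f + ∑ (map (N ∷_) ps ++ []) f           ≡⟨ cong₂ _+_ refl (∑-++ f (map (N ∷_) ps) []) ⟩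
  ∑ (map (E ∷_) ps) f + (∑ (map (N ∷_) ps) f + 0)
    ≡⟨ cong₂ _+_ (∑-map (E ∷_) f ps) (trans (+-identityʳ _) (∑-map (N ∷_) f ps)) ⟩
  ∑ ps (λ π → f (E ∷ π)) + ∑ ps (λ π → f (N ∷ π))           ∎
  where ps = paths n

-- Binomial coefficients

-- The coefficient (a − k choose b), which is 0 when k > a.
_∸_choose_ : ℕ → ℕ → ℕ → ℕ
a     ∸ zero  choose b = a C b
zero  ∸ suc k choose b = 0
suc a ∸ suc k choose b = a ∸ k choose b

-- At the edge `k = a + 1` the left side is C(0, b + 1) and the right side is 0 by convention; they
-- agree because the lower index is positive.
choose-pascal : ∀ a k b → suc a ∸ k choose suc b ≡ (a ∸ k choose b) + (a ∸ k choose suc b)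
choose-pascal a       zero          b = sym (nCk+nC[k+1]≡[n+1]C[k+1] a b)
choose-pascal zero    (suc zero)    b = k>n⇒nCk≡0 {0} {suc b} (s≤s z≤n)
choose-pascal zero    (suc (suc k)) b = refl
choose-pascal (suc a) (suc k)       b = choose-pascal a k b

choose-pascal² : ∀ a k b → suc (suc a) ∸ k choose suc (suc b) ≡
  (a ∸ k choose b) + (a ∸ k choose suc b) + ((a ∸ k choose suc b) + (a ∸ k choose suc (suc b)))
choose-pascal² a k b =
  trans (choose-pascal (suc a) k (suc b)) (cong₂ _+_ (choose-pascal a k b) (choose-pascal a k (suc b)))

-- The two middle entries of the odd row 2m + 1; in the walk their equality acts as the reflection
-- at 0.
central-symmetry : ∀ m → suc (m + m) C m ≡ suc (m + m) C suc m
central-symmetry m = trans (nCk≡nC[n∸k] (m≤n⇒m≤1+n (m≤m+n m m)))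
  (cong (suc (m + m) C_) (trans (cong (_∸ m) (sym (+-suc m m))) (m+n∸m≡n m (suc m))))

binomial-⊖ : ∀ a k b → binomial (a ⊖ k) (+ b) ≡ a ∸ k choose b
binomial-⊖ a       zero    b = refl
binomial-⊖ zero    (suc k) b = refl
binomial-⊖ (suc a) (suc k) b =
  trans (cong (λ i → binomial i (+ b)) (ℤₚ.[1+m]⊖[1+n]≡m⊖n a k)) (binomial-⊖ a k b)

binomial-choose : ∀ m k →
  binomial (+ (2 * suc m) - + k - + 2) (+ suc m - + 1) ≡ (m + m) ∸ k choose m
binomial-choose m k = begin
  binomial (+ (2 * suc m) - + k - + 2) (+ suc m - + 1) ≡⟨ cong₂ binomial upper (ℤₚ.[1+m]⊖[1+n]≡m⊖n m 0) ⟩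
  binomial ((m + m) ⊖ k) (+ m)                         ≡⟨ binomial-⊖ (m + m) k m ⟩
  (m + m) ∸ k choose m                                 ∎
  where
  double-suc : ∀ m → 2 * suc m ≡ 2 + (m + m)
  double-suc = solve-∀
  cancel : ∀ i j → (+ 2 ℤ.+ i) - j - + 2 ≡ i - j
  cancel = ℤ-Solver.solve-∀
  upper : + (2 * suc m) - + k - + 2 ≡ (m + m) ⊖ k
  upper = begin
    + (2 * suc m) - + k - + 2          ≡⟨ cong (λ a → + a - + k - + 2) (double-suc m) ⟩
    (+ 2 ℤ.+ + (m + m)) - + k - + 2    ≡⟨ cancel (+ (m + m)) (+ k) ⟩
    + (m + m) - + k                    ≡⟨ ℤₚ.m-n≡m⊖n (m + m) k ⟩
    (m + m) ⊖ k                        ∎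

-- The distance walk

-- The walks from distance d that are never at 0, by the reflection principle;
-- this is the case k = 0 of walks, where k counts the times 0, …, m at 0.
survivors : ℕ → ℕ → ℕ
survivors m zero    = 0
survivors m (suc d) = survivors m d + suc (m + m) C suc (d + m)

walks : ℕ → ℕ → ℕ → ℕ
walks m zero    d = survivors m d
walks m (suc j) d = 2 ^ j * ((m + m) ∸ j choose (d + m))

-- The distance after a step towards 0, reflected at 0.
below : ℕ → ℕ
below zero    = 1
below (suc d) = d

hit : ℕ → ℕ
hit zero    = 1
hit (suc _) = 0

-- `survivors m d` is a partial sum over row 2m + 1. Pascal's rule, applied twice, gives the
-- recurrence for each summand, hence for the sum by induction on `d`; at the absorbing boundary the
-- symmetry of the row closes the gap.
survivors-step : ∀ m d → survivors (suc m) (suc d) ≡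
  2 * survivors m (suc d) + (survivors m (2 + d) + survivors m d)
survivors-step m zero rewrite +-suc m m = begin
  suc (suc (suc (m + m))) C suc (suc m)              ≡⟨ choose-pascal² (suc (m + m)) 0 m ⟩
  (c m + c (1 + m)) + (c (1 + m) + c (2 + m))        ≡⟨ cong (λ x → (x + c (1 + m)) + (c (1 + m) + c (2 + m))) (central-symmetry m) ⟩
  (c (1 + m) + c (1 + m)) + (c (1 + m) + c (2 + m))  ≡⟨ rearrange (c (1 + m)) _ ⟩
  2 * c (1 + m) + (c (1 + m) + c (2 + m) + 0)        ∎
  where
  c = suc (m + m) C_
  rearrange : ∀ x y → (x + x) + (x + y) ≡ 2 * x + (x + y + 0)
  rearrange = solve-∀
survivors-step m (suc d) = begin
  survivors (suc m) (suc d) + suc (suc m + suc m) C suc (suc d + suc m)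
    ≡⟨ cong₂ _+_ (survivors-step m d) pascal ⟩
  (2 * s (1 + d) + (s (2 + d) + s d)) + (c (1 + d) + c (2 + d) + (c (2 + d) + c (3 + d)))
    ≡⟨ rearrange (s (1 + d)) (s (2 + d)) (s d) (c (1 + d)) (c (2 + d)) (c (3 + d)) ⟩
  2 * (s (1 + d) + c (2 + d)) + (s (2 + d) + c (3 + d) + (s d + c (1 + d))) ∎
  where
  s = survivors m
  c : ℕ → ℕ
  c i = suc (m + m) C (i + m)
  pascal : suc (suc m + suc m) C suc (suc d + suc m) ≡ c (1 + d) + c (2 + d) + (c (2 + d) + c (3 + d))
  pascal rewrite +-suc m m | +-suc d m = choose-pascal² (suc (m + m)) 0 (suc (d + m))
  rearrange : ∀ s₁ s₂ s₀ c₁ c₂ c₃ → (2 * s₁ + (s₂ + s₀)) + (c₁ + c₂ + (c₂ + c₃)) ≡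
    2 * (s₁ + c₂) + (s₂ + c₃ + (s₀ + c₁))
  rearrange = solve-∀

-- First-step analysis: of the four pairs of steps two keep the distance, one raises it and one
-- lowers it (at 0, both of these lead to 1). `hit d` records a visit at the starting time.
walks-step : ∀ m j d → walks (suc m) (hit d + j) d ≡
  2 * walks m j d + (walks m j (suc d) + walks m j (below d))
walks-step m zero (suc d) = survivors-step m d
-- The two steps away from 0 account for the two equal halves of C(2m + 2, m + 1).
walks-step m zero zero rewrite +-suc m m = begin
  suc (suc (m + m)) C suc m + 0        ≡⟨ cong (_+ 0) (choose-pascal (suc (m + m)) 0 m) ⟩
  (c m + c (suc m)) + 0                ≡⟨ +-identityʳ _ ⟩
  c m + c (suc m)                      ≡⟨ cong (_+ c (suc m)) (central-symmetry m) ⟩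
  c (suc m) + c (suc m)                ∎
  where c = suc (m + m) C_
-- Away from 0 no visit is used up: the upper index grows by 2, so Pascal's rule is applied twice.
walks-step m (suc j) (suc d) rewrite +-suc m m | +-suc d m = begin
  q * (suc (suc (m + m)) ∸ j choose suc (suc (d + m)))  ≡⟨ cong (q *_) (choose-pascal² (m + m) j (d + m)) ⟩
  q * (c d + c (1 + d) + (c (1 + d) + c (2 + d)))       ≡⟨ rearrange q (c d) (c (1 + d)) (c (2 + d)) ⟩
  2 * (q * c (1 + d)) + (q * c (2 + d) + q * c d)       ∎
  where
  q = 2 ^ j
  c : ℕ → ℕ
  c i = (m + m) ∸ j choose (i + m)
  rearrange : ∀ q x y z → q * (x + y + (y + z)) ≡ 2 * (q * y) + (q * z + q * x)
  rearrange = solve-∀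
-- At 0 a visit is used up: the power of 2 gains a factor, the upper index grows by 1 only, and
-- Pascal's rule is applied once.
walks-step m (suc j) zero rewrite +-suc m m = begin
  2 * q * (suc (m + m) ∸ j choose suc m)   ≡⟨ cong (2 * q *_) (choose-pascal (m + m) j m) ⟩
  2 * q * (c 0 + c 1)                      ≡⟨ rearrange q (c 0) (c 1) ⟩
  2 * (q * c 0) + (q * c 1 + q * c 1)      ∎
  where
  q = 2 ^ j
  c : ℕ → ℕ
  c i = (m + m) ∸ j choose (i + m)
  rearrange : ∀ q x y → 2 * q * (x + y) ≡ 2 * (q * x) + (q * y + q * y)
  rearrange = solve-∀

walks-zero : ∀ k d → walks 0 k d ≡ ⟦ hit d + 0 ≟ k ⟧
walks-zero zero          zero          = refl
walks-zero zero          (suc zero)    = refl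
-- Of the summands of `survivors 0`, only the first, C(1, 1), is nonzero.
walks-zero zero          (suc (suc d)) =
  cong₂ _+_ (walks-zero zero (suc d)) (k>n⇒nCk≡0 {1} {suc (suc d + 0)} (s≤s (s≤s z≤n)))
walks-zero (suc zero)    zero          = refl
walks-zero (suc zero)    (suc d)       = trans (*-identityˡ _) (k>n⇒nCk≡0 {0} {suc (d + 0)} (s≤s z≤n))
walks-zero (suc (suc j)) zero          = *-zeroʳ (2 ^ suc j)
walks-zero (suc (suc j)) (suc d)       = *-zeroʳ (2 ^ suc j)

-- Which mixed pair of steps widens the gap depends on the path that is ahead, so the two are taken
-- together.
neighbours : ∀ (g : ℕ → ℕ) a b →
  g (dist (suc a) b) + g (dist a (suc b)) ≡ g (suc (dist a b)) + g (below (dist a b))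
neighbours g zero    zero    = refl
neighbours g zero    (suc b) = +-comm (g b) _
neighbours g (suc a) zero    = cong (λ x → g (suc (suc a)) + g x) (∣-∣-identityʳ a)
neighbours g (suc a) (suc b) = neighbours g a b

-- Pairs of paths

adv : Step → ℕ → ℕ
adv E a = suc a
adv N a = a

east : ∀ {n} → ℕ → ℕ → Path n → ℕ
east a zero    _       = a
east a (suc m) []      = a
east a (suc m) (s ∷ π) = east (adv s a) m π

-- Unlike intersections, this includes the time 0.
visits : ∀ {n} → ℕ → ℕ → Path n → Path n → ℕ
visits a b []      []      = 0
visits a b (s ∷ π) (t ∷ ρ) = hit (dist a b) + visits (adv s a) (adv t b) π ρ

-- w is the indicator of a parity class; only w-law is used, and it makes the
-- choices of the last step independent of the class.
module Count (w : ℕ → ℕ) (w-law : ∀ x → w x + w (suc x) ≡ 1) where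

  -- The starting abscissas are free so that deleting the first steps leaves sums of the same kind;
  -- `c` carries the visit at the deleted time.
  weighted : ℕ → ∀ n → ℕ → ℕ → ℕ → ℕ
  weighted c n k a b = ∑ (paths n) λ π → ∑ (paths n) λ ρ →
    ⟦ c + visits a b π ρ ≟ k ⟧ * w (east a n π + east b n ρ)

  weighted-suc : ∀ n k a b → let c = hit (dist a b) in weighted 0 (suc n) k a b ≡
    (weighted c n k (suc a) (suc b) + weighted c n k (suc a) b) + (weighted c n k a (suc b) + weighted c n k a b)
  weighted-suc n k a b = trans (∑-paths n _) (cong₂ _+_ (split E) (split N))
    where
    g : Path (suc n) → Path (suc n) → ℕ
    g π ρ = ⟦ visits a b π ρ ≟ k ⟧ * w (east a (suc n) π + east b (suc n) ρ)
    split : ∀ s → ∑ (paths n) (λ π → ∑ (paths (suc n)) (g (s ∷ π))) ≡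
      weighted (hit (dist a b)) n k (adv s a) (suc b) + weighted (hit (dist a b)) n k (adv s a) b
    split s = trans (∑-cong (paths n) (λ π → ∑-paths n (g (s ∷ π)))) (∑-+ _ _ (paths n))

  -- Induction by deleting first steps; the class enters only in the base case, where just the last
  -- step remains.
  weighted-walks : ∀ m k a b → weighted 0 (suc m) k a b ≡ 2 * walks m k (dist a b)
  weighted-walks zero k a b = begin
    weighted 0 1 k a b ≡⟨ weighted-suc 0 k a b ⟩
    _           ≡⟨ cong (λ x → ((v * w (suc x) + 0 + 0) + (v * w (suc a + b) + 0 + 0)) +
                     ((v * w x + 0 + 0) + (v * w (a + b) + 0 + 0))) (+-suc a b) ⟩
    _           ≡⟨ rearrange v (w (a + b)) (w (suc (a + b))) (w (suc (suc (a + b)))) ⟩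
    v * (w (a + b) + w (suc (a + b)) + (w (suc (a + b)) + w (suc (suc (a + b)))))
      -- The last steps lead to the sums a + b, a + b + 1 (twice) and a + b + 2: two pairs of
      -- consecutive values, each of total weight 1.
      ≡⟨ cong₂ (λ x y → v * (x + y)) (w-law (a + b)) (w-law (suc (a + b))) ⟩
    v * 2       ≡⟨ *-comm v 2 ⟩
    2 * v       ≡⟨ cong (2 *_) (walks-zero k (dist a b)) ⟨
    2 * walks 0 k (dist a b) ∎
    where
    v = ⟦ hit (dist a b) + 0 ≟ k ⟧
    rearrange : ∀ v x y z → ((v * z + 0 + 0) + (v * y + 0 + 0)) + ((v * y + 0 + 0) + (v * x + 0 + 0)) ≡
      v * (x + y + (y + z))
    rearrange = solve-∀
  weighted-walks (suc m) k a b = trans (weighted-suc (suc m) k a b) (split (dist a b) refl k)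
    where
    rearrange : ∀ x y z → (2 * x + 2 * y) + (2 * z + 2 * x) ≡ 2 * (2 * x + (y + z))
    rearrange = solve-∀
    four : ℕ → ℕ → ℕ
    four c k = (weighted c (suc m) k (suc a) (suc b) + weighted c (suc m) k (suc a) b) +
      (weighted c (suc m) k a (suc b) + weighted c (suc m) k a b)
    step : ∀ j → four 0 j ≡ 2 * walks (suc m) (hit (dist a b) + j) (dist a b)
    step j = begin
      four 0 j
        ≡⟨ cong₂ _+_ (cong₂ _+_ (weighted-walks m j (suc a) (suc b)) (weighted-walks m j (suc a) b))
                     (cong₂ _+_ (weighted-walks m j a (suc b)) (weighted-walks m j a b)) ⟩
      (2 * g (dist a b) + 2 * g (dist (suc a) b)) + (2 * g (dist a (suc b)) + 2 * g (dist a b))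
        ≡⟨ rearrange (g (dist a b)) (g (dist (suc a) b)) (g (dist a (suc b))) ⟩
      2 * (2 * g (dist a b) + (g (dist (suc a) b) + g (dist a (suc b))))
        ≡⟨ cong (λ x → 2 * (2 * g (dist a b) + x)) (neighbours g a b) ⟩
      2 * (2 * g (dist a b) + (g (suc (dist a b)) + g (below (dist a b))))
        ≡⟨ cong (2 *_) (walks-step m j (dist a b)) ⟨
      2 * walks (suc m) (hit (dist a b) + j) (dist a b) ∎
      where g = walks m j
    -- The visit already counted excludes `k = 0`; every indicator computes to 0.
    none : ∀ a b → weighted 1 (suc m) 0 a b ≡ 0
    none a b = trans (∑-cong (paths (suc m)) (λ _ → ∑-zero (paths (suc m)))) (∑-zero (paths (suc m)))
    -- The distance is abstracted so that `hit d` computes. At distance 0 the current visit cancels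
    -- one unit of the target.
    split : ∀ d → dist a b ≡ d → ∀ k → four (hit d) k ≡ 2 * walks (suc m) k d
    split (suc d) eq k       = subst (λ d → four 0 k ≡ 2 * walks (suc m) (hit d + k) d) eq (step k)
    split zero    eq (suc k) = subst (λ d → four 0 k ≡ 2 * walks (suc m) (hit d + k) d) eq (step k)
    split zero    eq zero    =
      cong₂ _+_ (cong₂ _+_ (none (suc a) (suc b)) (none (suc a) b)) (cong₂ _+_ (none a (suc b)) (none a b))

-- Coordinates and meeting times

east-suc : ∀ {n} a m (π : Path n) → east (suc a) m π ≡ suc (east a m π)
east-suc a zero    π       = refl
east-suc a (suc m) []      = refl
east-suc a (suc m) (E ∷ π) = east-suc (suc a) m π
east-suc a (suc m) (N ∷ π) = east-suc a m π

east-≤ : ∀ {n} m (π : Path n) → east 0 m π ≤ m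
east-≤ zero    π       = z≤n
east-≤ (suc m) []      = z≤n
east-≤ (suc m) (E ∷ π) rewrite east-suc 0 m π = s≤s (east-≤ m π)
east-≤ (suc m) (N ∷ π) = m≤n⇒m≤1+n (east-≤ m π)

-- The coordinates add up to `m`, so meeting at time `m` means equal east counts. `after` applies
-- the first step last while `east` accumulates it; `east-suc` reconciles the two orders.
after-east : ∀ {n} m (π : Path n) → m ≤ n → after m π ≡ (+ east 0 m π , + m - + east 0 m π)
after-east zero    π       _         = refl
after-east (suc m) (E ∷ π) (s≤s m≤n) rewrite after-east m π m≤n | east-suc 0 m π =
  cong₂ _,_ (cong +_ (+-comm x 1)) (trans (ℤₚ.m-n≡m⊖n m x) (sym (ℤₚ.[1+m]⊖[1+n]≡m⊖n m x)))
  where x = east 0 m π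
after-east (suc m) (N ∷ π) (s≤s m≤n) rewrite after-east m π m≤n =
  cong₂ _,_ refl (shift (+ m) (+ east 0 m π))
  where
  shift : ∀ i j → (i - j) ℤ.+ + 1 ≡ (+ 1 ℤ.+ i) - j
  shift = ℤ-Solver.solve-∀

hit-dist : ∀ x y → ⟦ x ≟ y ⟧ ≡ hit (dist x y)
hit-dist zero    zero    = refl
hit-dist zero    (suc y) = refl
hit-dist (suc x) zero    = refl
hit-dist (suc x) (suc y) = hit-dist x y

hit-after : ∀ {n} m (π ρ : Path n) → m ≤ n →
  ⟦ after m π ≟ₚ after m ρ ⟧ ≡ hit (dist (east 0 m π) (east 0 m ρ))
hit-after m π ρ m≤n rewrite after-east m π m≤n | after-east m ρ m≤n =
  trans (⟦⟧-cong (_ ≟ₚ _) (east 0 m π ≟ east 0 m ρ)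
          (mk⇔ (ℤₚ.+-injective ∘ cong proj₁) (cong (λ x → + x , + m - + x))))
        (hit-dist (east 0 m π) (east 0 m ρ))

-- Each step shifts the times and moves the starting points, so the induction needs arbitrary `f`,
-- `a` and `b`.
visits-∑ : ∀ {n} (π ρ : Path n) a b (f g : ℕ → ℕ) →
  (∀ i → i ≤ n → g (f i) ≡ hit (dist (east a i π) (east b i ρ))) →
  ∑ (applyUpTo f n) g ≡ visits a b π ρ
visits-∑ []      []      a b f g eq = refl
visits-∑ (s ∷ π) (t ∷ ρ) a b f g eq = cong₂ _+_ (eq 0 z≤n)
  (visits-∑ π ρ (adv s a) (adv t b) (f ∘ suc) g (λ i i≤n → eq (suc i) (s≤s i≤n)))

-- Both counts stop before the endpoint; the extra 1 is the common origin at time 0.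
visits-intersections : ∀ {m} (π ρ : Path (suc m)) → visits 0 0 π ρ ≡ suc (intersections π ρ)
visits-intersections {m} (s ∷ π) (t ∷ ρ) = cong suc (sym (trans
  (length-filter (λ i → after i (s ∷ π) ≟ₚ after i (t ∷ ρ)) (applyUpTo suc m))
  (visits-∑ π ρ (adv s 0) (adv t 0) suc _ (λ i i≤m → hit-after (suc i) (s ∷ π) (t ∷ ρ) (s≤s i≤m)))))

-- Counting pairs by their endpoints

eastEnd : ∀ {n} → Path n → ℕ
eastEnd {n} π = east 0 n π

endpoint-⇔ : ∀ {n} (π : Path n) r → endpoint π ≡ (+ r , + n - + r) ⇔ eastEnd π ≡ r
endpoint-⇔ {n} π r rewrite after-east n π ≤-refl =
  mk⇔ (ℤₚ.+-injective ∘ cong proj₁) (cong (λ x → + x , + n - + x))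

counted-⟦⟧ : ∀ n k r s (π ρ : Path n) → ⟦ counted? n k (+ r) (+ s) (π , ρ) ⟧ ≡
  ⟦ eastEnd π ≟ r ⟧ * (⟦ eastEnd ρ ≟ s ⟧ * ⟦ intersections π ρ ≟ k ⟧)
counted-⟦⟧ n k r s π ρ = begin
  ⟦ π? ×-dec ρ? ×-dec k? ⟧       ≡⟨ ⟦⟧-× π? (ρ? ×-dec k?) ⟩
  ⟦ π? ⟧ * ⟦ ρ? ×-dec k? ⟧       ≡⟨ cong (⟦ π? ⟧ *_) (⟦⟧-× ρ? k?) ⟩
  ⟦ π? ⟧ * (⟦ ρ? ⟧ * ⟦ k? ⟧)     ≡⟨ cong₂ (λ x y → x * (y * ⟦ k? ⟧))
                                     (⟦⟧-cong π? (eastEnd π ≟ r) (endpoint-⇔ π r))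
                                     (⟦⟧-cong ρ? (eastEnd ρ ≟ s) (endpoint-⇔ ρ s)) ⟩
  ⟦ eastEnd π ≟ r ⟧ * (⟦ eastEnd ρ ≟ s ⟧ * ⟦ k? ⟧) ∎
  where
  π? = endpoint π ≟ₚ (+ r , + n - + r)
  ρ? = endpoint ρ ≟ₚ (+ s , + n - + s)
  k? = intersections π ρ ≟ k

pairs : ∀ n → List (Path n × Path n)
pairs n = cartesianProduct (paths n) (paths n)

-- Double counting: once the sums are exchanged, each pair of paths selects exactly one `(r , s)`,
-- its own east counts, which lie in the range by `east-≤`.
sumM-pairs : ∀ n k t → sumM n k t ≡ ∑ (pairs n) λ (π , ρ) →
  ⟦ + (eastEnd π + eastEnd ρ) ℤ.≟ t ⟧ * ⟦ intersections π ρ ≟ k ⟧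
sumM-pairs n k t = begin
  sumM n k t
    ≡⟨ ∑-filter (λ (r , s) → + (r + s) ℤ.≟ t) (λ (r , s) → M n k (+ r) (+ s)) ends ⟩
  ∑ ends (λ (r , s) → ⟦ + (r + s) ℤ.≟ t ⟧ * M n k (+ r) (+ s))
    ≡⟨ ∑-cong ends (λ (r , s) → trans
         (cong (⟦ + (r + s) ℤ.≟ t ⟧ *_) (length-filter (counted? n k (+ r) (+ s)) (pairs n)))
         (sym (∑-*ˡ ⟦ + (r + s) ℤ.≟ t ⟧ _ (pairs n)))) ⟩
  ∑ ends (λ (r , s) → ∑ (pairs n) λ πρ → ⟦ + (r + s) ℤ.≟ t ⟧ * ⟦ counted? n k (+ r) (+ s) πρ ⟧)
    ≡⟨ ∑-swap (λ (r , s) πρ → ⟦ + (r + s) ℤ.≟ t ⟧ * ⟦ counted? n k (+ r) (+ s) πρ ⟧) ends (pairs n) ⟩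
  ∑ (pairs n) (λ πρ → ∑ ends λ (r , s) → ⟦ + (r + s) ℤ.≟ t ⟧ * ⟦ counted? n k (+ r) (+ s) πρ ⟧)
    ≡⟨ ∑-cong (pairs n) (λ (π , ρ) → collapse π ρ) ⟩
  ∑ (pairs n) (λ (π , ρ) → ⟦ + (eastEnd π + eastEnd ρ) ℤ.≟ t ⟧ * ⟦ intersections π ρ ≟ k ⟧) ∎
  where
  range = upTo (suc n)
  ends = cartesianProduct range range
  rearrange : ∀ a b c d → a * (b * (c * d)) ≡ b * (c * (a * d))
  rearrange = solve-∀
  collapse : ∀ π ρ → ∑ ends (λ (r , s) → ⟦ + (r + s) ℤ.≟ t ⟧ * ⟦ counted? n k (+ r) (+ s) (π , ρ) ⟧) ≡
    ⟦ + (eastEnd π + eastEnd ρ) ℤ.≟ t ⟧ * ⟦ intersections π ρ ≟ k ⟧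
  collapse π ρ = begin
    ∑ ends (λ (r , s) → ⟦ + (r + s) ℤ.≟ t ⟧ * ⟦ counted? n k (+ r) (+ s) (π , ρ) ⟧)
      ≡⟨ ∑-cong ends (λ (r , s) → trans (cong (⟦ + (r + s) ℤ.≟ t ⟧ *_) (counted-⟦⟧ n k r s π ρ))
           (rearrange ⟦ + (r + s) ℤ.≟ t ⟧ ⟦ x ≟ r ⟧ ⟦ y ≟ s ⟧ i)) ⟩
    ∑ ends (λ (r , s) → ⟦ x ≟ r ⟧ * (⟦ y ≟ s ⟧ * (⟦ + (r + s) ℤ.≟ t ⟧ * i)))
      ≡⟨ ∑-× (λ (r , s) → ⟦ x ≟ r ⟧ * (⟦ y ≟ s ⟧ * (⟦ + (r + s) ℤ.≟ t ⟧ * i))) range range ⟩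
    ∑ range (λ r → ∑ range λ s → ⟦ x ≟ r ⟧ * (⟦ y ≟ s ⟧ * (⟦ + (r + s) ℤ.≟ t ⟧ * i)))
      ≡⟨ ∑-cong range (λ r → trans
           (∑-*ˡ ⟦ x ≟ r ⟧ (λ s → ⟦ y ≟ s ⟧ * (⟦ + (r + s) ℤ.≟ t ⟧ * i)) range)
           (cong (⟦ x ≟ r ⟧ *_)
             (∑-pick (suc n) (λ s → ⟦ + (r + s) ℤ.≟ t ⟧ * i) (s≤s (east-≤ n ρ))))) ⟩
    ∑ range (λ r → ⟦ x ≟ r ⟧ * (⟦ + (r + y) ℤ.≟ t ⟧ * i))
      ≡⟨ ∑-pick (suc n) (λ r → ⟦ + (r + y) ℤ.≟ t ⟧ * i) (s≤s (east-≤ n π)) ⟩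
    ⟦ + (x + y) ℤ.≟ t ⟧ * i ∎
    where
    x = eastEnd π
    y = eastEnd ρ
    i = ⟦ intersections π ρ ≟ k ⟧

-- Parity

even odd : ℕ → ℕ
even zero    = 1
even (suc x) = odd x
odd zero    = 0
odd (suc x) = even x

even+odd : ∀ x → even x + odd x ≡ 1
even+odd zero    = refl
even+odd (suc x) = trans (+-comm (odd x) (even x)) (even+odd x)

-- For even `x` the bound keeps the only solution x/2 in the range. In the form `j * 2`, a successor
-- of `j` exposes two successors, which cancel those of `x`.
even-∑ : ∀ b x → x ≤ b * 2 → ∑ (upTo (suc b)) (λ j → ⟦ x ≟ j * 2 ⟧) ≡ even x
even-∑ b zero _ = trans (∑-upTo-suc b (λ j → ⟦ 0 ≟ j * 2 ⟧)) (cong suc (∑-zero (upTo b)))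
even-∑ b (suc zero) _ = trans (∑-upTo-suc b (λ j → ⟦ 1 ≟ j * 2 ⟧)) (∑-zero (upTo b))
even-∑ (suc b) (suc (suc x)) (s≤s (s≤s x≤b*2)) =
  trans (∑-upTo-suc (suc b) (λ j → ⟦ 2 + x ≟ j * 2 ⟧)) (even-∑ b x x≤b*2)

odd-∑ : ∀ b x → x ≤ b * 2 → ∑ (upTo (suc b)) (λ j → ⟦ x ≟ 1 + j * 2 ⟧) ≡ odd x
odd-∑ b zero    _       = ∑-zero (upTo (suc b))
odd-∑ b (suc x) x<b*2 = even-∑ b x (<⇒≤ x<b*2)

double-pos : ∀ j → + 2 ℤ.* + j ≡ + (j * 2)
double-pos j = trans (sym (ℤₚ.pos-* 2 j)) (cong +_ (*-comm 2 j))

-- One argument for both classes, applied with `t p` = 2p, `c = 0` and with `t p` = 2p + 1, `c = 1`.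
-- Negative `p` make `t p` negative, so only the nonnegative half of the interval contributes.
module _
  (w : ℕ → ℕ) (w-law : ∀ x → w x + w (suc x) ≡ 1)
  (c : ℕ) (t : ℤ → ℤ)
  (t-pos : ∀ j → t (+ j) ≡ + (c + j * 2))
  (t-neg : ∀ x j → + x ≢ t -[1+ j ])
  (w-∑ : ∀ b x → x ≤ b * 2 → ∑ (upTo (suc b)) (λ j → ⟦ x ≟ c + j * 2 ⟧) ≡ w x)
  where

  ∑-interval : ∀ b x → x ≤ b * 2 → ∑ (symmetricInterval b) (λ p → ⟦ + x ℤ.≟ t p ⟧) ≡ w x
  ∑-interval b x x≤b*2 = begin
    ∑ (symmetricInterval b) f             ≡⟨ ∑-++ f (map +_ (upTo (suc b))) _ ⟩
    ∑ (map +_ (upTo (suc b))) f + ∑ (map -[1+_] (upTo b)) f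
      ≡⟨ cong₂ _+_ (∑-map +_ f (upTo (suc b))) (∑-map -[1+_] f (upTo b)) ⟩
    ∑ (upTo (suc b)) (f ∘ +_) + ∑ (upTo b) (f ∘ -[1+_])
      ≡⟨ cong₂ _+_ (∑-cong (upTo (suc b)) positive)
           (∑-cong (upTo b) (λ j → ⟦⟧-false (+ x ℤ.≟ t -[1+ j ]) (t-neg x j))) ⟩
    ∑ (upTo (suc b)) (λ j → ⟦ x ≟ c + j * 2 ⟧) + ∑ (upTo b) (λ _ → 0)
      ≡⟨ cong₂ _+_ (w-∑ b x x≤b*2) (∑-zero (upTo b)) ⟩
    w x + 0                               ≡⟨ +-identityʳ (w x) ⟩
    w x                                   ∎
    where
    f : ℤ → ℕ
    f p = ⟦ + x ℤ.≟ t p ⟧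
    positive : ∀ j → f (+ j) ≡ ⟦ x ≟ c + j * 2 ⟧
    positive j = ⟦⟧-cong (+ x ℤ.≟ t (+ j)) (x ≟ c + j * 2)
      (mk⇔ (λ eq → ℤₚ.+-injective (trans eq (t-pos j))) (λ eq → trans (cong +_ eq) (sym (t-pos j))))

  outside : ∀ b x p → x ≤ b * 2 → b < ℤ.∣ p ∣ → + x ≢ t p
  outside b x (+ j)    x≤b*2 b<j eq = <⇒≱ (*-monoˡ-< 2 b<j)
    (≤-trans (m≤n+m (j * 2) c) (≤-trans (≤-reflexive (sym (ℤₚ.+-injective (trans eq (t-pos j))))) x≤b*2))
  outside b x -[1+ j ] _     _   eq = t-neg x j eq

  parity-class-sum : ∀ m k → SumOverℤ (λ p → sumM (suc m) k (t p)) Is (2 * walks m (suc k) 0)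
  -- The two east counts add up to at most 2n, so only `p` ≤ n can occur.
  parity-class-sum m k = n , support , total
    where
    n = suc m
    open Count w w-law
    x : Path n × Path n → ℕ
    x (π , ρ) = eastEnd π + eastEnd ρ
    x≤ : ∀ πρ → x πρ ≤ n * 2
    x≤ (π , ρ) = ≤-trans (+-mono-≤ (east-≤ n π) (east-≤ n ρ)) (≤-reflexive (n+n≡n*2 n))
      where
      n+n≡n*2 : ∀ n → n + n ≡ n * 2
      n+n≡n*2 = solve-∀
    i : Path n × Path n → ℕ
    i (π , ρ) = ⟦ intersections π ρ ≟ k ⟧
    support : ∀ p → n < ℤ.∣ p ∣ → sumM n k (t p) ≡ 0
    support p n<p = begin
      sumM n k (t p)                                     ≡⟨ sumM-pairs n k (t p) ⟩
      ∑ (pairs n) (λ πρ → ⟦ + x πρ ℤ.≟ t p ⟧ * i πρ)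
        ≡⟨ ∑-cong (pairs n) (λ πρ → cong (_* i πρ)
             (⟦⟧-false (+ x πρ ℤ.≟ t p) (outside n (x πρ) p (x≤ πρ) n<p))) ⟩
      ∑ (pairs n) (λ _ → 0)                              ≡⟨ ∑-zero (pairs n) ⟩
      0                                                  ∎
    total : ∑ (symmetricInterval n) (λ p → sumM n k (t p)) ≡ 2 * walks m (suc k) 0
    total = begin
      ∑ I (λ p → sumM n k (t p))
        ≡⟨ ∑-cong I (λ p → sumM-pairs n k (t p)) ⟩
      ∑ I (λ p → ∑ (pairs n) λ πρ → ⟦ + x πρ ℤ.≟ t p ⟧ * i πρ)
        ≡⟨ ∑-swap (λ p πρ → ⟦ + x πρ ℤ.≟ t p ⟧ * i πρ) I (pairs n) ⟩
      ∑ (pairs n) (λ πρ → ∑ I λ p → ⟦ + x πρ ℤ.≟ t p ⟧ * i πρ)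
        ≡⟨ ∑-cong (pairs n) (λ πρ → trans (∑-*ʳ (i πρ) (λ p → ⟦ + x πρ ℤ.≟ t p ⟧) I)
             (trans (cong (_* i πρ) (∑-interval n (x πρ) (x≤ πρ))) (*-comm (w (x πρ)) (i πρ)))) ⟩
      ∑ (pairs n) (λ πρ → i πρ * w (x πρ))
        -- The target becomes `suc k` because `visits` also counts the origin.
        ≡⟨ ∑-cong (pairs n) (λ (π , ρ) →
             cong (λ v → ⟦ v ≟ suc k ⟧ * w (x (π , ρ))) (visits-intersections π ρ)) ⟨
      ∑ (pairs n) (λ (π , ρ) → ⟦ visits 0 0 π ρ ≟ suc k ⟧ * w (x (π , ρ)))
        ≡⟨ ∑-× (λ (π , ρ) → ⟦ visits 0 0 π ρ ≟ suc k ⟧ * w (x (π , ρ))) (paths n) (paths n) ⟩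
      weighted 0 n (suc k) 0 0
        ≡⟨ weighted-walks m (suc k) 0 0 ⟩
      2 * walks m (suc k) 0 ∎
      where I = symmetricInterval n

walks-binomial : ∀ m k → 2 * walks m (suc k) 0 ≡
  2 ^ (k + 1) * binomial (+ (2 * suc m) - + k - + 2) (+ suc m - + 1)
walks-binomial m k rewrite +-comm k 1 | binomial-choose m k = sym (*-assoc 2 (2 ^ k) _)

theorem3 : (n k : ℕ) → 1 ≤ n →
    (SumOverℤ (N-O n k) Is (2 ^ (k + 1) * binomial (+ (2 * n) - + k - + 2) (+ n - + 1))) ×
    (SumOverℤ (N-E n k) Is (2 ^ (k + 1) * binomial (+ (2 * n) - + k - + 2) (+ n - + 1)))
theorem3 (suc m) k _ =
  subst (SumOverℤ (N-O (suc m) k) Is_) (walks-binomial m k)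
    (parity-class-sum odd (λ x → trans (+-comm (odd x) (even x)) (even+odd x)) 1 (λ p → + 2 ℤ.* p ℤ.+ + 1)
      (λ j → trans (cong (ℤ._+ + 1) (double-pos j)) (cong +_ (+-comm (j * 2) 1)))
      odd-neg odd-∑ m k) ,
  subst (SumOverℤ (N-E (suc m) k) Is_) (walks-binomial m k)
    (parity-class-sum even even+odd 0 (+ 2 ℤ.*_) double-pos (λ _ _ ()) even-∑ m k)
  where
  odd-neg : ∀ x j → + x ≢ + 2 ℤ.* -[1+ j ] ℤ.+ + 1
  -- The rewrites bring the right side, -(2j + 1), into the form `-[1+_]`.
  odd-neg x j eq rewrite +-suc j (j + 0) | ℤₚ.[1+m]⊖[1+n]≡m⊖n 0 (suc (j + (j + 0))) with eq
  ... | ()
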